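{- Let $G$ be a finite, simple, connected graph and let $k\geq 3$ be an integer. Then $$\gamma_{B_k}(G)=\min\{\gamma_{B_k}(T)\colon T \text{ is a spanning tree of } G\}.$$
   Context: $d(u,v)$ denotes the distance in the graph. For a connected graph $G$ and an integer $k\ge 1$, a function $f\colon V(G)\to\{0,1,\dots,k\}$ is a dominating $k$-broadcast on $G$ if for every $u\in V(G)$ there is a vertex $v$ with $f(v)\geq 1$ and $d(u,v)\leq f(v)$. Its cost is $\omega(f)=\sum_{u\in V(G)}f(u)$, and the dominating $k$-broadcast number $\gamma_{B_k}(G)$ is the minimum cost of a dominating $k$-broadcast on $G$. -}

module Defs where

open import Data.Nat using (ℕ; zero; suc; _≤_; _≤?_; z≤n; s≤s; NonZero)
open import Data.Nat.Properties using (+-0-commutativeMonoid) renaming (_≟_ to _≟ℕ_)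
open import Data.Fin using (Fin; zero; suc; toℕ) renaming (_≟_ to _≟F_)
open import Data.Fin.Properties using (any?; all?)
open import Data.List using (List; []; _∷_)
open import Data.List.Relation.Unary.Unique.Propositional using (Unique)
open import Data.Product using (∃; ∃-syntax; Σ-syntax; _×_; _,_; proj₁; proj₂)
import Data.Vec.Functional as VF
open import Level using (Level; 0ℓ)
open import Relation.Binary.Core using (Rel)
open import Relation.Binary.Definitions using (Decidable; Symmetric)
open import Relation.Binary.PropositionalEquality using (_≡_; refl; sym; trans; cong; subst; _≗_)
open import Relation.Nullary using (¬_; Dec; yes; no; contradiction)
open import Relation.Nullary.Decidable using (_×-dec_; map′)
open import Algebra.Properties.CommutativeMonoid.Sum +-0-commutativeMonoid using (sum; sum-cong-≗)

IsMinimum : {ℓ : Level} → (ℕ → Set ℓ) → ℕ → Set ℓ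
IsMinimum P m = P m × (∀ m′ → P m′ → m ≤ m′)

least : {ℓ : Level} {P : ℕ → Set ℓ} → (∀ m → Dec (P m)) → ∀ m → P m → ∃ (IsMinimum P)
least P? zero p = zero , p , λ _ _ → z≤n
least {P = P} P? (suc m) p with P? zero
... | yes p₀ = zero , p₀ , λ _ _ → z≤n
... | no ¬p₀ with least (λ i → P? (suc i)) m p
...   | l , pl , min = suc l , pl , minimal
  where
  minimal : ∀ m′ → P m′ → suc l ≤ m′
  minimal zero     q = contradiction q ¬p₀
  minimal (suc m′) q = s≤s (min m′ q)

record Graph (n : ℕ) : Set₁ where
  field
    Adj        : Rel (Fin n) 0ℓ
    adj?       : Decidable Adj
    adj-sym    : Symmetric Adj
    adj-irrefl : ∀ v → ¬ Adj v v

open Graph public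

-- Walk G u ℓ v is the type of walks of length ℓ from u to v.
data Walk {n : ℕ} (G : Graph n) : Fin n → ℕ → Fin n → Set where
  nil  : ∀ {u} → Walk G u zero u
  cons : ∀ {u w v ℓ} → Adj G u w → Walk G w ℓ v → Walk G u (suc ℓ) v

vertices : ∀ {n} {G : Graph n} {u ℓ v} → Walk G u ℓ v → List (Fin n)
vertices {u = u} nil        = u ∷ []
vertices {u = u} (cons _ p) = u ∷ vertices p

record Connected {n : ℕ} (G : Graph n) : Set where
  field
    nonEmpty : NonZero n
    walk     : ∀ u v → ∃[ ℓ ] Walk G u ℓ v

-- A cycle v₀ v₁ … v_ℓ v₀ with ℓ ≥ 2 and v₀, …, v_ℓ pairwise distinct.
record Cycle {n : ℕ} (G : Graph n) : Set where
  field
    {start end} : Fin n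
    {len}       : ℕ
    path        : Walk G start len end
    distinct    : Unique (vertices path)
    long        : 2 ≤ len
    closing     : Adj G end start

record IsTree {n : ℕ} (T : Graph n) : Set where
  field
    connected : Connected T
    acyclic   : ¬ Cycle T

record IsSpanningTree {n : ℕ} (T G : Graph n) : Set where
  field
    subgraph : ∀ {u v} → Adj T u v → Adj G u v
    isTree   : IsTree T

  open IsTree isTree public

walk? : ∀ {n} (G : Graph n) u v ℓ → Dec (Walk G u ℓ v)
walk? G u v zero = map′ (λ { refl → nil }) (λ { nil → refl }) (u ≟F v)
walk? G u v (suc ℓ) =
  map′ (λ { (_ , a , p) → cons a p }) (λ { (cons a p) → _ , a , p })
       (any? λ w → adj? G u w ×-dec walk? G w v ℓ)

dist-exists : ∀ {n} (G : Graph n) → Connected G → ∀ u v →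
              ∃ (IsMinimum λ ℓ → Walk G u ℓ v)
dist-exists G conn u v = let (ℓ , p) = Connected.walk conn u v in least (walk? G u v) ℓ p

dist : ∀ {n} (G : Graph n) → Connected G → Fin n → Fin n → ℕ
dist G conn u v = proj₁ (dist-exists G conn u v)

-- toℕ identifies Fin (suc k) with {0, 1, …, k}.
Broadcast : ℕ → ℕ → Set
Broadcast n k = Fin n → Fin (suc k)

IsDominating : ∀ {n k} (G : Graph n) → Connected G → Broadcast n k → Set
IsDominating G conn f =
  ∀ u → ∃[ v ] (1 ≤ toℕ (f v)) × (dist G conn u v ≤ toℕ (f v))

cost : ∀ {n k} → Broadcast n k → ℕ
cost f = sum (λ u → toℕ (f u))

IsDominatingCost : ∀ {n} → ℕ → (G : Graph n) → Connected G → ℕ → Set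
IsDominatingCost {n} k G conn c =
  Σ[ f ∈ Broadcast n k ] IsDominating G conn f × cost f ≡ c

anyFunction? : ∀ {ℓ} n {m} {P : (Fin n → Fin m) → Set ℓ} →
               (∀ {f g} → f ≗ g → P f → P g) → (∀ f → Dec (P f)) → Dec (∃ P)
anyFunction? zero ext P? =
  map′ (λ p → VF.[] , p) (λ { (f , p) → ext {f} {VF.[]} (λ ()) p }) (P? VF.[])
anyFunction? (suc n) {P = P} ext P? =
  map′ (λ { (x , f , p) → x VF.∷ f , p })
       (λ { (f , p) → VF.head f , VF.tail f ,
              ext {f} {VF.head f VF.∷ VF.tail f} (λ { zero → refl ; (suc _) → refl }) p })
       (any? λ x → anyFunction? n {P = λ f → P (x VF.∷ f)}
          (λ {f} {g} e → ext {x VF.∷ f} {x VF.∷ g} (λ { zero → refl ; (suc i) → e i }))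
          (λ f → P? (x VF.∷ f)))

isDominatingCost? : ∀ {n} k (G : Graph n) (conn : Connected G) c →
                    Dec (IsDominatingCost k G conn c)
isDominatingCost? {n} k G conn c = anyFunction? n ext dec
  where
  P : Broadcast n k → Set
  P f = IsDominating G conn f × cost f ≡ c

  ext : ∀ {f g} → f ≗ g → P f → P g
  ext {f} {g} e (dom , eq) =
    (λ u → let (v , pos , near) = dom u in
           v , subst (λ x → 1 ≤ toℕ x) (e v) pos
             , subst (λ x → dist G conn u v ≤ toℕ x) (e v) near)
    , trans (sum-cong-≗ (λ u → cong toℕ (sym (e u)))) eq

  dec : ∀ f → Dec (P f)
  dec f = (all? λ u → any? λ v → (1 ≤? toℕ (f v)) ×-dec (dist G conn u v ≤? toℕ (f v)))
          ×-dec (cost f ≟ℕ c)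

dominatingCost-exists : ∀ {n} k .{{_ : NonZero k}} (G : Graph n) (conn : Connected G) →
                        ∃ (IsDominatingCost k G conn)
dominatingCost-exists {n} (suc k) G conn = cost ones , ones , dominating , refl
  where
  ones : Broadcast n (suc k)
  ones _ = suc zero

  dist-self≤1 : ∀ u → dist G conn u u ≤ 1
  dist-self≤1 u with dist-exists G conn u u
  ... | _ , _ , min with min 0 nil
  ...   | z≤n = z≤n

  dominating : IsDominating G conn ones
  dominating u = u , s≤s z≤n , dist-self≤1 u

γB-exists : ∀ {n} k .{{_ : NonZero k}} (G : Graph n) (conn : Connected G) →
            ∃ (IsMinimum (IsDominatingCost k G conn))
γB-exists k G conn =
  let (c , p) = dominatingCost-exists k G conn in least (isDominatingCost? k G conn) c p

γB : ∀ {n} k .{{_ : NonZero k}} (G : Graph n) → Connected G → ℕ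
γB k G conn = proj₁ (γB-exists k G conn)

{-# OPTIONS --safe #-}
-- Given a dominating broadcast f of G, send every vertex u towards the broadcasting
-- vertex v that maximises f v − d(u,v).  The next vertex on a shortest path to v has a
-- strictly larger maximum, so these edges form a forest in which every vertex u still
-- reaches some broadcasting vertex r within f r steps.  Extending the forest to a
-- spanning tree T of G, f dominates T at the same cost.  Conversely distances in a
-- spanning tree are at least those in G.
module Submission where

open import Defs
open import Data.Bool using (Bool; true; false; not; _xor_; if_then_else_)
open import Data.Bool.Properties using (not-injective; ¬-not) renaming (_≟_ to _≟B_)
open import Data.Empty using (⊥)
open import Data.Fin using (Fin; toℕ; _≟_)
open import Data.Fin.Properties using (any?; toℕ≤pred[n])
open import Data.List using ([]; _∷_; allFin; cartesianProduct)
open import Data.List.Membership.Propositional using (_∈_; _∉_)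
open import Data.List.Membership.Propositional.Properties using (∈-allFin; ∈-cartesianProduct⁺)
open import Data.List.Relation.Unary.All as All using (All; []; _∷_)
open import Data.List.Relation.Unary.All.Properties using (All¬⇒¬Any)
open import Data.List.Relation.Unary.AllPairs using (_∷_)
open import Data.List.Relation.Unary.Any using (here; there)
open import Data.Nat using (ℕ; zero; suc; _+_; _≤_; _<_; _≤?_; s≤s; s≤s⁻¹; NonZero)
open import Data.Nat.Induction using (<-wellFounded)
open import Data.Nat.Properties using (≤-refl; ≤-reflexive; ≤-trans; ≤-antisym; <-≤-trans; <⇒≤; <-irrefl; ≤-<-trans; ≤⇒≯; m≤n+m; +-identityʳ; +-suc; +-cancelʳ-≤; +-monoˡ-≤; +-monoʳ-≤; +-monoʳ-<)
open import Data.Product using (∃; ∃-syntax; Σ-syntax; _×_; _,_; proj₁; proj₂)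
open import Data.Sum as Sum using (_⊎_; inj₁; inj₂)
open import Data.Unit using (⊤)
open import Function using (id; _∘_)
open import Induction.WellFounded using (Acc; acc)
open import Relation.Binary.PropositionalEquality using (_≡_; _≢_; refl; sym; trans; cong; cong₂; subst)
open import Relation.Nullary using (¬_; Dec; yes; no; does; contradiction)
open import Relation.Nullary.Decidable using (_×-dec_; _⊎-dec_; dec-true; dec-false)

private variable
  n : ℕ

-- Walks and distances

_⊆ᵍ_ : Graph n → Graph n → Set
T ⊆ᵍ G = ∀ {u v} → Adj T u v → Adj G u v

Reach : Graph n → Fin n → Fin n → Set
Reach G u v = ∃[ ℓ ] Walk G u ℓ v

walk-mono : {T G : Graph n} → T ⊆ᵍ G → ∀ {u ℓ v} → Walk T u ℓ v → Walk G u ℓ v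
walk-mono T⊆G nil        = nil
walk-mono T⊆G (cons a p) = cons (T⊆G a) (walk-mono T⊆G p)

reach-mono : {T G : Graph n} → T ⊆ᵍ G → ∀ {u v} → Reach T u v → Reach G u v
reach-mono T⊆G (ℓ , p) = ℓ , walk-mono T⊆G p

reach-trans : (G : Graph n) → ∀ {u v w} → Reach G u v → Reach G v w → Reach G u w
reach-trans G (_ , nil)      q = q
reach-trans G (_ , cons a p) q = let (_ , r) = reach-trans G (_ , p) q in _ , cons a r

reach-adj : (G : Graph n) → ∀ {u v} → Adj G u v → Reach G u v
reach-adj G a = _ , cons a nil

reach-bind : {T G : Graph n} → (∀ {u v} → Adj G u v → Reach T u v) →
             ∀ {u v} → Reach G u v → Reach T u v
reach-bind         h (_ , nil)      = _ , nil
reach-bind {T = T} h (_ , cons a p) = reach-trans T (h a) (reach-bind h (_ , p))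

module _ (G : Graph n) (conn : Connected G) where

  dist-walk : ∀ u v → Walk G u (dist G conn u v) v
  dist-walk u v = proj₁ (proj₂ (dist-exists G conn u v))

  dist-≤ : ∀ {u v ℓ} → Walk G u ℓ v → dist G conn u v ≤ ℓ
  dist-≤ {u} {v} {ℓ} p = proj₂ (proj₂ (dist-exists G conn u v)) ℓ p

-- Acyclicity from cuts

-- Certifies that an edge between `a` and `b` is a bridge. Such certificates can be repaired each
-- time an edge is added, with no need to analyse cycles of the larger graph.
record Cut (T : Graph n) (a b : Fin n) : Set where
  field
    side     : Fin n → Bool
    separate : side a ≢ side b
    only     : ∀ {x y} → Adj T x y → side x ≢ side y → (x ≡ a × y ≡ b) ⊎ (x ≡ b × y ≡ a)

cut-sym : {T : Graph n} → ∀ {a b} → Cut T a b → Cut T b a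
cut-sym C = record { side = side ; separate = separate ∘ sym ; only = λ e → Sum.swap ∘ only e }
  where open Cut C

end∈vertices : {G : Graph n} → ∀ {u ℓ v} (p : Walk G u ℓ v) → v ∈ vertices p
end∈vertices nil        = here refl
end∈vertices (cons _ p) = there (end∈vertices p)

start∈vertices : {G : Graph n} → ∀ {u ℓ v} (p : Walk G u ℓ v) → u ∈ vertices p
start∈vertices nil        = here refl
start∈vertices (cons _ p) = here refl

module _ {T : Graph n} {a b : Fin n} (C : Cut T a b) where
  open Cut C

  -- In either orientation, the only edge that crosses the cut has `b` as an end.
  same-side : ∀ {x y} → Adj T x y → x ≢ b → y ≢ b → side x ≡ side y
  same-side {x} {y} e x≢b y≢b with side x ≟B side y
  ... | yes s = s
  ... | no ¬s with only e ¬s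
  ...   | inj₁ (_ , y≡b) = contradiction y≡b y≢b
  ...   | inj₂ (x≡b , _) = contradiction x≡b x≢b

  same-side-walk : ∀ {x ℓ y} (p : Walk T x ℓ y) → b ∉ vertices p → side x ≡ side y
  same-side-walk nil        b∉ = refl
  same-side-walk (cons e p) b∉ =
    trans (same-side e (λ { refl → b∉ (here refl) }) (λ { refl → b∉ (there (start∈vertices p)) }))
          (same-side-walk p (b∉ ∘ there))

-- The cut of the closing edge is crossed by no other edge of the cycle: neither by the
-- first edge of the path, whose second vertex is not the end, nor by a later one,
-- which avoids the start.
cuts⇒acyclic : {T : Graph n} → (∀ {a b} → Adj T a b → Cut T a b) → ¬ Cycle T
cuts⇒acyclic cut
  record { start = s ; end = t ; path = cons {w = w} e (cons e′ p)
         ; distinct = s∉ ∷ w∉ ∷ _ ; long = s≤s (s≤s _) ; closing = c } =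
  separate (sym (trans first-edge (same-side-walk C (cons e′ p) (All¬⇒¬Any s∉))))
  where
  C = cut c
  open Cut C

  first-edge : side s ≡ side w
  first-edge with side s ≟B side w
  ... | yes eq = eq
  ... | no neq with only e neq
  ...   | inj₁ (s≡t , _) = contradiction s≡t (All.lookup s∉ (there (end∈vertices p)))
  ...   | inj₂ (_ , w≡t) = contradiction w≡t (All.lookup w∉ (end∈vertices p))

-- Growing forests

-- The fibres of label are the components of graph.
record Forest (G : Graph n) : Set₁ where
  field
    graph      : Graph n
    subgraph   : graph ⊆ᵍ G
    label      : Fin n → Fin n
    label-adj  : ∀ {x y} → Adj graph x y → label x ≡ label y
    label-walk : ∀ {x y} → label x ≡ label y → Reach graph x y
    cut        : ∀ {a b} → Adj graph a b → Cut graph a b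

open Forest

emptyForest : (G : Graph n) → Forest G
emptyForest G = record
  { graph      = record { Adj = λ _ _ → ⊥ ; adj? = λ _ _ → no id ; adj-sym = id ; adj-irrefl = λ _ → id }
  ; subgraph   = λ ()
  ; label      = id
  ; label-adj  = λ ()
  ; label-walk = λ { refl → _ , nil }
  ; cut        = λ ()
  }

-- Adding an edge between two components

relabel : Fin n → Fin n → Fin n → Fin n
relabel a b c = if does (c ≟ a) then b else c

relabel-≡ : ∀ (a b : Fin n) {c} → c ≡ a → relabel a b c ≡ b
relabel-≡ a b {c} c≡a rewrite dec-true (c ≟ a) c≡a = refl

relabel-≢ : ∀ (a b : Fin n) {c} → c ≢ a → relabel a b c ≡ c
relabel-≢ a b {c} c≢a rewrite dec-false (c ≟ a) c≢a = refl

xor-cancelˡ : ∀ x {y z} → x xor y ≡ x xor z → y ≡ z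
xor-cancelˡ true  = not-injective
xor-cancelˡ false = id

module AddEdge {G : Graph n} (F : Forest G) {u v : Fin n}
               (uv : Adj G u v) (apart : label F u ≢ label F v) where

  Adj⁺ : Fin n → Fin n → Set
  Adj⁺ x y = Adj (graph F) x y ⊎ ((x ≡ u × y ≡ v) ⊎ (x ≡ v × y ≡ u))

  graph⁺ : Graph n
  graph⁺ = record
    { Adj        = Adj⁺
    ; adj?       = λ x y → adj? (graph F) x y ⊎-dec (((x ≟ u) ×-dec (y ≟ v)) ⊎-dec ((x ≟ v) ×-dec (y ≟ u)))
    ; adj-sym    = λ { (inj₁ e)                    → inj₁ (adj-sym (graph F) e)
                     ; (inj₂ (inj₁ (refl , refl))) → inj₂ (inj₂ (refl , refl))
                     ; (inj₂ (inj₂ (refl , refl))) → inj₂ (inj₁ (refl , refl)) }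
    ; adj-irrefl = λ { x (inj₁ e)                 → adj-irrefl (graph F) x e
                     ; x (inj₂ (inj₁ (refl , eq))) → apart (cong (label F) eq)
                     ; x (inj₂ (inj₂ (refl , eq))) → apart (cong (label F) (sym eq)) }
    }

  old : graph F ⊆ᵍ graph⁺
  old = inj₁

  new : Adj⁺ u v
  new = inj₂ (inj₁ (refl , refl))

  -- The component of `u` takes over the label of `v`, not conversely; `descending-forest` relies on
  -- this direction.
  label⁺ : Fin n → Fin n
  label⁺ x = relabel (label F u) (label F v) (label F x)

  label⁺-u≡v : label⁺ u ≡ label⁺ v
  label⁺-u≡v = trans (relabel-≡ (label F u) (label F v) refl)
                     (sym (relabel-≢ (label F u) (label F v) (apart ∘ sym)))

  label⁺-adj : ∀ {x y} → Adj⁺ x y → label⁺ x ≡ label⁺ y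
  label⁺-adj (inj₁ e)                    = cong (relabel _ _) (label-adj F e)
  label⁺-adj (inj₂ (inj₁ (refl , refl))) = label⁺-u≡v
  label⁺-adj (inj₂ (inj₂ (refl , refl))) = sym label⁺-u≡v

  old-walk : ∀ {x y} → label F x ≡ label F y → Reach graph⁺ x y
  old-walk = reach-mono old ∘ label-walk F

  -- If exactly one end lay in the component of `u`, the other lay in that of `v`, and the walk goes
  -- through the new edge. Otherwise the old labels already agree.
  label⁺-walk : ∀ {x y} → label⁺ x ≡ label⁺ y → Reach graph⁺ x y
  label⁺-walk {x} {y} eq with label F x ≟ label F u | label F y ≟ label F u
  ... | yes x~u | yes y~u = old-walk (trans x~u (sym y~u))
  ... | yes x~u | no  _   =
    reach-trans graph⁺ (old-walk x~u) (reach-trans graph⁺ (reach-adj graph⁺ new) (old-walk eq))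
  ... | no  _   | yes y~u =
    reach-trans graph⁺ (old-walk eq)
      (reach-trans graph⁺ (reach-adj graph⁺ (adj-sym graph⁺ new)) (old-walk (sym y~u)))
  ... | no  _   | no  _   = old-walk eq

  -- One side is the old component of `u`. Labels are constant along old edges, so no old edge
  -- leaves it.
  new-cut : Cut graph⁺ u v
  new-cut = record { side = side ; separate = separate ; only = only }
    where
    side : Fin n → Bool
    side x = does (label F x ≟ label F u)

    separate : side u ≢ side v
    separate eq with () ← trans (sym (dec-true (label F u ≟ label F u) refl))
                                (trans eq (dec-false (label F v ≟ label F u) (apart ∘ sym)))

    only : ∀ {x y} → Adj⁺ x y → side x ≢ side y → (x ≡ u × y ≡ v) ⊎ (x ≡ v × y ≡ u)
    only (inj₁ e) neq = contradiction (cong (λ l → does (l ≟ label F u)) (label-adj F e)) neq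
    only (inj₂ e) neq = e

  level-cut : ∀ {a b} (C : Cut (graph F) a b) → Cut.side C u ≡ Cut.side C v → Cut graph⁺ a b
  level-cut {a} {b} C u~v = record { side = side ; separate = separate ; only = only⁺ }
    where
    open Cut C
    only⁺ : ∀ {x y} → Adj⁺ x y → side x ≢ side y → (x ≡ a × y ≡ b) ⊎ (x ≡ b × y ≡ a)
    only⁺ (inj₁ e)                    neq = only e neq
    only⁺ (inj₂ (inj₁ (refl , refl))) neq = contradiction u~v neq
    only⁺ (inj₂ (inj₂ (refl , refl))) neq = contradiction (sym u~v) neq

  -- Swapping the sides on the component of u keeps the old edges crossing as before.
  flip-cut : ∀ {a b} → Adj (graph F) a b → (C : Cut (graph F) a b) → Cut.side C u ≢ Cut.side C v →
             Σ[ C′ ∈ Cut (graph F) a b ] Cut.side C′ u ≡ Cut.side C′ v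
  flip-cut {a} {b} ab C u≁v = record { side = flipped ; separate = separate′ ; only = only′ } , level
    where
    open Cut C
    flipped : Fin n → Bool
    flipped x = does (label F x ≟ label F u) xor side x

    separate′ : flipped a ≢ flipped b
    separate′ eq rewrite label-adj F ab = separate (xor-cancelˡ (does (label F b ≟ label F u)) eq)

    only′ : ∀ {x y} → Adj (graph F) x y → flipped x ≢ flipped y → (x ≡ a × y ≡ b) ⊎ (x ≡ b × y ≡ a)
    only′ e neq = only e λ eq → neq (cong₂ (λ l s → does (l ≟ label F u) xor s) (label-adj F e) eq)

    -- `u` is flipped and `v`, in another component, is not, so two different Booleans become equal.
    level : flipped u ≡ flipped v
    level rewrite dec-true (label F u ≟ label F u) refl
                | dec-false (label F v ≟ label F u) (apart ∘ sym) = sym (¬-not (u≁v ∘ sym))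

  old-cut : ∀ {a b} → Adj (graph F) a b → Cut graph⁺ a b
  old-cut ab with Cut.side (cut F ab) u ≟B Cut.side (cut F ab) v
  ... | yes u~v = level-cut (cut F ab) u~v
  ... | no  u≁v = let (C′ , u~v) = flip-cut ab (cut F ab) u≁v in level-cut C′ u~v

  forest⁺ : Forest G
  forest⁺ = record
    { graph      = graph⁺
    ; subgraph   = λ { (inj₁ e)                    → subgraph F e
                     ; (inj₂ (inj₁ (refl , refl))) → uv
                     ; (inj₂ (inj₂ (refl , refl))) → adj-sym G uv }
    ; label      = label⁺
    ; label-adj  = label⁺-adj
    ; label-walk = label⁺-walk
    ; cut        = λ { (inj₁ e)                    → old-cut e
                     ; (inj₂ (inj₁ (refl , refl))) → new-cut
                     ; (inj₂ (inj₂ (refl , refl))) → cut-sym new-cut }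
    }

-- Extending a forest to a spanning tree

_≼_ : {G : Graph n} → Forest G → Forest G → Set
F ≼ F′ = graph F ⊆ᵍ graph F′

-- A fold over a list of tasks: monotonicity of `Done` keeps finished tasks finished, while `Inv` is
-- re-established at each step for the current forest only.
exhaust : ∀ {A : Set} {G : Graph n} (Inv : Forest G → Set) (Done : A → Forest G → Set) →
          (∀ x F F′ → F ≼ F′ → Done x F → Done x F′) →
          (∀ x F → Inv F → Σ[ F′ ∈ Forest G ] F ≼ F′ × Inv F′ × Done x F′) →
          ∀ xs F → Inv F → Σ[ F′ ∈ Forest G ] F ≼ F′ × Inv F′ × All (λ x → Done x F′) xs
exhaust Inv Done mono step []       F inv = F , id , inv , []
exhaust Inv Done mono step (x ∷ xs) F inv =
  let (F₁ , F≼F₁ , inv₁ , done)  = step x F inv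
      (F₂ , F₁≼F₂ , inv₂ , rest) = exhaust Inv Done mono step xs F₁ inv₁
  in F₂ , F₁≼F₂ ∘ F≼F₁ , inv₂ , mono x F₁ F₂ F₁≼F₂ done ∷ rest

-- Kruskal's greedy procedure started from `F`: all pairs of vertices are inspected, and an edge of
-- `G` is added when its ends have different labels. Afterwards the ends of every edge of `G` are
-- joined, so walks of `G` can be replaced by walks of the forest.
extend-to-spanning : {G : Graph n} → Connected G → (F : Forest G) →
                     Σ[ T ∈ Graph n ] IsSpanningTree T G × graph F ⊆ᵍ T
extend-to-spanning {n = n} {G} conn F =
  let (F′ , F≼F′ , _ , done) = exhaust (λ _ → ⊤) Joined joined-mono join
                                 (cartesianProduct (allFin n) (allFin n)) F _
      reach : ∀ {x y} → Adj G x y → Reach (graph F′) x y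
      reach {x} {y} = All.lookup done (∈-cartesianProduct⁺ (∈-allFin x) (∈-allFin y))
  in graph F′ , record
       { subgraph = subgraph F′
       ; isTree   = record
         { connected = record
           { nonEmpty = Connected.nonEmpty conn
           ; walk     = λ u v → reach-bind reach (Connected.walk conn u v)
           }
         ; acyclic   = cuts⇒acyclic (cut F′)
         }
       } , F≼F′
  where
  Joined : Fin n × Fin n → Forest G → Set
  Joined (u , v) F = Adj G u v → Reach (graph F) u v

  joined-mono : ∀ x F F′ → F ≼ F′ → Joined x F → Joined x F′
  joined-mono _ _ _ F≼F′ joined uv = reach-mono F≼F′ (joined uv)

  join : ∀ x F → ⊤ → Σ[ F′ ∈ Forest G ] F ≼ F′ × ⊤ × Joined x F′
  join (u , v) F _ with label F u ≟ label F v | adj? G u v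
  ... | yes u~v | _      = F , id , _ , λ _ → label-walk F u~v
  ... | no  _   | no ¬uv = F , id , _ , λ uv → contradiction uv ¬uv
  ... | no  u≁v | yes uv = forest⁺ , old , _ , λ _ → reach-adj graph⁺ new
    where open AddEdge F uv u≁v

-- Forests that descend along a rank

module _ (rank : Fin n → ℕ) (Root : Fin n → Set) where

  Descends : Graph n → Fin n → Set
  Descends T u = Root u ⊎ (∃[ w ] Adj T u w × rank w < rank u)

  descends-mono : ∀ T T′ → T ⊆ᵍ T′ → ∀ u → Descends T u → Descends T′ u
  descends-mono _ _ T⊆T′ _ (inj₁ root)        = inj₁ root
  descends-mono _ _ T⊆T′ _ (inj₂ (w , e , r)) = inj₂ (w , T⊆T′ e , r)

  -- Labels are the tops of the partially built components: an edge from u to a vertex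
  -- of smaller rank never closes a cycle when u is still its own label.
  Topped : {G : Graph n} → Forest G → Set
  Topped F = (∀ x → rank (label F x) ≤ rank x) × (∀ x → Descends (graph F) x ⊎ label F x ≡ x)

  descending-forest : {G : Graph n} → (∀ u → Descends G u) → Σ[ F ∈ Forest G ] (∀ u → Descends (graph F) u)
  descending-forest {G} descends =
    let (F , _ , _ , done) = exhaust Topped (λ u F → Descends (graph F) u)
                               (λ u F F′ F≼F′ → descends-mono (graph F) (graph F′) F≼F′ u) link (allFin n)
                               (emptyForest G) ((λ _ → ≤-refl) , λ _ → inj₂ refl)
    in F , λ u → All.lookup done (∈-allFin u)
    where
    link : ∀ u F → Topped F → Σ[ F′ ∈ Forest G ] F ≼ F′ × Topped F′ × Descends (graph F′) u
    link u F topped@(low , tops) with tops u | descends u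
    ... | inj₁ done | _         = F , id , topped , done
    ... | inj₂ _    | inj₁ root = F , id , topped , inj₁ root
    ... | inj₂ top  | inj₂ (w , uw , w<u) = forest⁺ , old , (low⁺ , tops⁺) , done
      where
      -- The label of `w` ranks no higher than `w`, hence strictly below `u`, which is its own
      -- label. So `u` and `w` lie in different components.
      below : rank (label F w) < rank (label F u)
      below = subst (λ x → rank (label F w) < rank x) (sym top) (≤-<-trans (low w) w<u)

      open AddEdge F uw (λ eq → <-irrefl (cong rank (sym eq)) below)

      done : Descends graph⁺ u
      done = inj₂ (w , new , w<u)

      low⁺ : ∀ x → rank (label⁺ x) ≤ rank x
      low⁺ x with label F x ≟ label F u
      ... | yes x~u = ≤-trans (<⇒≤ below) (subst (λ y → rank y ≤ rank x) x~u (low x))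
      ... | no  _   = low x

      tops⁺ : ∀ x → Descends graph⁺ x ⊎ label⁺ x ≡ x
      tops⁺ x with tops x
      ... | inj₁ d = inj₁ (descends-mono (graph F) graph⁺ old x d)
      -- Distinct vertices that are their own labels lie in different components, so `u` is the only
      -- such vertex to be relabelled, and it has just received its edge.
      ... | inj₂ x-top with x ≟ u
      ...   | yes refl = inj₁ done
      ...   | no  x≢u  = inj₂ (trans (relabel-≢ _ _ λ x~u → x≢u (trans (sym x-top) (trans x~u top))) x-top)

-- Broadcasts

dominating-mono : ∀ {k} {T G : Graph n} (connT : Connected T) (connG : Connected G) → T ⊆ᵍ G →
                  (f : Broadcast n k) → IsDominating T connT f → IsDominating G connG f
dominating-mono {T = T} {G} connT connG T⊆G f dom u =
  let (v , pos , near) = dom u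
  in v , pos , ≤-trans (dist-≤ G connG (walk-mono T⊆G (dist-walk T connT u v))) near

-- A spanning tree dominated by a given broadcast

module _ {k} (G : Graph n) (conn : Connected G) (f : Broadcast n k) (dom : IsDominating G conn f) where

  -- Some broadcasting `v` satisfies k - (f v - d(u,v)) ≤ i, written without truncated subtraction.
  -- Since f v ≤ k, the left side is never negative, so a least `i` loses nothing.
  Within : Fin n → ℕ → Set
  Within u i = ∃[ v ] (1 ≤ toℕ (f v)) × (dist G conn u v + k ≤ toℕ (f v) + i)

  within? : ∀ u i → Dec (Within u i)
  within? u i = any? λ v → (1 ≤? toℕ (f v)) ×-dec (dist G conn u v + k ≤? toℕ (f v) + i)

  -- Domination of `u` means that the maximum of f v - d(u,v) is at least 0.
  within-k : ∀ u → Within u k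
  within-k u = let (v , pos , near) = dom u in v , pos , +-monoˡ-≤ k near

  rank-exists : ∀ u → ∃ (IsMinimum (Within u))
  rank-exists u = least (within? u) k (within-k u)

  -- k minus the maximum of f v − d(u,v) over the broadcasting vertices v.
  rank : Fin n → ℕ
  rank u = proj₁ (rank-exists u)

  rank-≤ : ∀ u {i} → Within u i → rank u ≤ i
  rank-≤ u {i} = proj₂ (proj₂ (rank-exists u)) i

  -- `u` broadcasts and attains its own maximum: the inequality is that of `Within` at distance 0.
  Root : Fin n → Set
  Root u = 1 ≤ toℕ (f u) × k ≤ toℕ (f u) + rank u

  descends : ∀ u → Descends rank Root G u
  descends u with proj₁ (proj₂ (rank-exists u))
  ... | v , pos , near with dist G conn u v | dist-walk G conn u v
  ...   | zero  | nil = inj₁ (pos , near)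
  ...   | suc ℓ | cons {w = w} e p = inj₂ (w , e , closer (rank u) near)
    where
    closer : ∀ i → suc ℓ + k ≤ toℕ (f v) + i → rank w < i
    -- At rank 0, a maximiser at positive distance would need a broadcast value above `k`.
    closer zero near₀ = contradiction
      (≤-trans (s≤s (m≤n+m k ℓ)) (≤-trans near₀ (≤-reflexive (+-identityʳ _))))
      (≤⇒≯ (toℕ≤pred[n] (f v)))
    -- The tail of the shortest path bounds the distance from `w` to `v` by `ℓ`; the unit saved
    -- lowers the rank bound by one.
    closer (suc i) nearᵢ = s≤s (rank-≤ w
      (v , pos , ≤-trans (+-monoˡ-≤ k (dist-≤ G conn p))
                         (s≤s⁻¹ (≤-trans nearᵢ (≤-reflexive (+-suc _ i))))))

  -- Each step of the walk lowers the rank by at least 1, and `Root` supplies the inequality with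
  -- `ℓ` = 0 where the walk stops. The vertex reached need not be the maximiser that defined the
  -- rank of `u`.
  descend : {T : Graph n} → (∀ u → Descends rank Root T u) → ∀ u → Acc _<_ (rank u) →
            ∃[ v ] ∃[ ℓ ] (1 ≤ toℕ (f v)) × Walk T u ℓ v × (ℓ + k ≤ toℕ (f v) + rank u)
  descend desc u (acc rs) with desc u
  ... | inj₁ (pos , near)  = u , 0 , pos , nil , near
  ... | inj₂ (w , e , w<u) =
    let (v , ℓ , pos , p , near) = descend desc w (rs w<u)
    in v , suc ℓ , pos , cons e p , <-≤-trans (s≤s near) (+-monoʳ-< (toℕ (f v)) w<u)

  dominating-descends : {T : Graph n} (connT : Connected T) → (∀ u → Descends rank Root T u) →
                        IsDominating T connT f
  dominating-descends {T} connT desc u =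
    let (v , ℓ , pos , p , near) = descend desc u (<-wellFounded (rank u))
    -- As `rank u` is at most `k`, cancelling `k` leaves ℓ ≤ f v.
    in v , pos , ≤-trans (dist-≤ T connT p)
                   (+-cancelʳ-≤ k ℓ _ (≤-trans near (+-monoʳ-≤ (toℕ (f v)) (rank-≤ u (within-k u)))))

  dominated-spanning-tree : Σ[ T ∈ Graph n ] Σ[ st ∈ IsSpanningTree T G ]
                            IsDominating T (IsSpanningTree.connected st) f
  dominated-spanning-tree =
    let (F , desc)    = descending-forest rank Root descends
        (T , st , F⊆T) = extend-to-spanning conn F
    in T , st , dominating-descends (IsSpanningTree.connected st)
                  (λ u → descends-mono rank Root (graph F) T F⊆T u (desc u))

-- Comparing broadcast numbers

module _ (k : ℕ) .{{_ : NonZero k}} (G : Graph n) (conn : Connected G) where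

  γB-attained : IsDominatingCost k G conn (γB k G conn)
  γB-attained = proj₁ (proj₂ (γB-exists k G conn))

  γB-≤ : ∀ {c} → IsDominatingCost k G conn c → γB k G conn ≤ c
  γB-≤ {c} = proj₂ (proj₂ (γB-exists k G conn)) c

γB-antimono : ∀ k .{{_ : NonZero k}} {T G : Graph n} (connT : Connected T) (connG : Connected G) →
              T ⊆ᵍ G → γB k G connG ≤ γB k T connT
γB-antimono k {T} {G} connT connG T⊆G =
  let (f , dom , eq) = γB-attained k T connT
  in γB-≤ k G connG (f , dominating-mono connT connG T⊆G f dom , eq)

theorem2 : (n : ℕ) (G : Graph n) (conn : Connected G) (k : ℕ) .{{_ : NonZero k}} → 3 ≤ k →
    IsMinimum
    (λ c → Σ[ T ∈ Graph n ] Σ[ st ∈ IsSpanningTree T G ] γB k T (IsSpanningTree.connected st) ≡ c)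
    (γB k G conn)
theorem2 n G conn k _ =
  let (f , dom , eq)  = γB-attained k G conn
      (T , st , domT) = dominated-spanning-tree G conn f dom
      connT           = IsSpanningTree.connected st
  in (T , st , ≤-antisym (γB-≤ k T connT (f , domT , eq))
                         (γB-antimono k connT conn (IsSpanningTree.subgraph st)))
   , λ { _ (_ , st′ , refl) →
           γB-antimono k (IsSpanningTree.connected st′) conn (IsSpanningTree.subgraph st′) }
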